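{- Let $S$ be a polygonal surface in $\mathbb{R}^2$, let $F(S)$ be its framework, and let $w$ be a self-stress on $F(S)$. Let $f,f'$ be faces of $S$. Then the lift $\tau_{\gamma,w}(f,f')$ does not depend on the choice of the oriented face-path $\gamma$ from $f$ to $f'$ within its class of homotopic oriented face-paths: if $\gamma$ and $\gamma'$ are homotopic oriented face-paths from $f$ to $f'$, then $\tau_{\gamma,w}(f,f')=\tau_{\gamma',w}(f,f')$.
   Context: Polygonal surfaces. A polygon in $\mathbb{R}^n$ is flat if all its vertices lie in one two-dimensional plane and its boundary has no self-intersections (it need not be convex). A polygonal surface (with boundary) in $\mathbb{R}^n$, $n\ge 2$, is a mapping of a CW-complex of a surface (with boundary) to $\mathbb{R}^n$ such that each face corresponds to a flat polygon. Self-intersections of the image are allowed. Surfaces are compact, and their boundary is homeomorphic to a disjoint (possibly empty) collection of circles. The framework $F(S)$ is the 1-skeleton of $S$: a finite connected graph without loops and multiple edges whose vertices $v_i$ are placed at points $p_i\in\mathbb{R}^2$ and whose edges are straight segments. Self-stresses. A stress $w$ on $F(S)$ assigns a real number $w_{ij}=w_{ji}$ to each edge $p_ip_j$ (also written $w(p_ip_j)$). It is a self-stress if $\sum_{\{j\,:\,v_iv_j \text{ an edge}\}} w_{ij}(p_i-p_j)=0$ at every vertex $v_i$. Face-paths. A face-path $\gamma$ of length $N\geq 1$ from $f_0$ to $f_N$ is a sequence of faces $(f_0,\dots,f_N)$ of $S$ together with a sequence of edges $(p_1q_1,\dots,p_Nq_N)$ such that $p_iq_i$ is a common edge of $f_{i-1}$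 and $f_i$ for all $i$ (if $f_{i-1}=f_i$, any edge of that face is allowed). A face is oriented if its edges are oriented so as to form an oriented loop. The orientations of two distinct faces agree at a common edge $e$ if their oriented edge loops pass $e$ in opposite directions. The face-path is oriented if each of its faces and edges is oriented so that the orientations of consecutive distinct faces $f_{i-1},f_i$ agree at $p_iq_i$ (a repeated face $f_{i-1}=f_i$ keeps its orientation), and the edge $p_iq_i$ is oriented from $p_i$ to $q_i$ by the orientation of $f_{i-1}$. Orientations are attached to the entries of the path, not to the faces of $S$, so on a non-orientable surface a path may visit the same face with opposite orientations. Lifts. For a step $i$ of an oriented face-path, the elementary lift is the linear (i.e. affine) function on $\mathbb{R}^2$ $$L_{f_{i-1}}^{f_i}(p)=\det(p_i-q_i,\;p_i-p)\cdot w(p_iq_i)\cdot\rho(f_{i-1},f_i),$$ where $\rho(f,g)=1$ if $f,g$ are different faces of $S$ and $\rho(f,g)=0$ otherwise. The lift from $f_0$ to $f_N$ with respect to $\gamma$ and $w$ is $\tau_{\gamma,w}(f_0,f_N)=\sum_{i=1}^N L_{f_{i-1}}^{f_i}$. Homotopy. Two oriented face-paths are homotopic if one is taken to the other by a finite sequence of the following moves and their inverses (orientations of the initial face and of retained entries are kept). (1) Between consecutive entries $f_i,f_{i+1}$ joined through an edge $e$, insert two copies $g,g$ of a face $g$ adjacent to $e$, where the steps $f_i\to g$ and $g\to f_{i+1}$ use the edge $e$, and the step $g\to g$ uses any edge of $g$. (2) Between consecutive entries $f_i,f_{i+1}$ joined through an edge $e$, insert $g_1,\dots,g_k$, a loop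 of all the faces around an endpoint $v$ of $e$, listed in cyclic order: $g_s$ and $g_{s+1}$ share an edge at $v$ through which the path passes, $g_k$ and $g_1$ share the edge $e$, and the steps $f_i\to g_1$ and $g_k\to f_{i+1}$ use the edge $e$. -}

module Defs where

open import Algebra.Bundles using (CommutativeRing; CommutativeMonoid)
import Algebra.Properties.CommutativeSemigroup as CommutativeSemigroupProperties
import Algebra.Properties.Group as GroupProperties
open import Data.Bool.Base using (if_then_else_)
open import Data.Fin.Base using (Fin; toℕ)
open import Data.Fin.Properties using (any?; _≟_)
open import Data.List.Base using (List; []; _∷_; foldr; map; filter; allFin)
open import Data.List.Membership.Propositional using (_∈_)
open import Data.List.Relation.Unary.All using (All)
open import Data.List.Relation.Unary.AllPairs using (AllPairs)
open import Data.List.Relation.Unary.Unique.Propositional using (Unique)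
open import Data.Nat.Base as ℕ using (ℕ; suc)
open import Data.Nat.DivMod using (_mod_)
import Data.Nat.Properties as ℕP
open import Data.Product.Base using (∃-syntax; _×_; _,_; proj₁; proj₂)
open import Data.Rational.Base as ℚ using (ℚ; 0ℚ; 1ℚ; ½)
import Data.Rational.Properties as ℚP
open import Data.Sign.Base using (Sign) renaming (+ to pos; - to neg)
open import Data.Sum.Base using (_⊎_)
open import Function.Base using (_∘_)
open import Level using (0ℓ)
open import Relation.Binary.Construct.Closure.Equivalence using (EqClosure)
open import Relation.Binary.Construct.Closure.ReflexiveTransitive using (Star)
open import Relation.Binary.Construct.Closure.Transitive
  using (TransClosure; [_]; _∷_; _++_; _∷ʳ_)
open import Relation.Binary.PropositionalEquality
  using (_≡_; _≢_; refl; sym; trans; cong; cong₂; subst; module ≡-Reasoning)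
open import Relation.Nullary using (¬_; Dec; does)
open import Relation.Nullary.Decidable using (_×-dec_; _⊎-dec_)

-- A real number is a Cauchy sequence of rationals; equality is the setoid _≈_.
Cauchy : (ℕ → ℚ) → Set
Cauchy x = ∀ ε → 0ℚ ℚ.< ε →
  ∃[ N ] ∀ m n → N ℕ.≤ m → N ℕ.≤ n → ℚ.∣ x m ℚ.- x n ∣ ℚ.< ε

record ℝ : Set where
  no-eta-equality
  constructor mkℝ
  field
    seq    : ℕ → ℚ
    cauchy : Cauchy seq

open ℝ

infix 4 _≈_ _<_ _≤_

record _≈_ (x y : ℝ) : Set where
  constructor mk≈
  field
    close : ∀ ε → 0ℚ ℚ.< ε →
      ∃[ N ] ∀ n → N ℕ.≤ n → ℚ.∣ seq x n ℚ.- seq y n ∣ ℚ.< ε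

open _≈_

_<_ : ℝ → ℝ → Set
x < y = ∃[ ε ] (0ℚ ℚ.< ε × ∃[ N ] ∀ n → N ℕ.≤ n → seq x n ℚ.+ ε ℚ.≤ seq y n)

_≤_ : ℝ → ℝ → Set
x ≤ y = ¬ (y < x)

private
  module _ where
    open import Data.Rational.Base using (_+_; _*_; _-_; -_; ∣_∣) renaming (_<_ to _<ᵣ_; _≤_ to _≤ᵣ_)
    open GroupProperties ℚP.+-0-group using (⁻¹-involutive)
    open CommutativeSemigroupProperties
      (CommutativeMonoid.commutativeSemigroup ℚP.+-0-commutativeMonoid) using (interchange)

    a-b+b≡a : ∀ a b → (a - b) + b ≡ a
    a-b+b≡a a b = begin
      (a - b) + b    ≡⟨ ℚP.+-assoc a (- b) b ⟩
      a + (- b + b)  ≡⟨ cong (a +_) (ℚP.+-inverseˡ b) ⟩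
      a + 0ℚ         ≡⟨ ℚP.+-identityʳ a ⟩
      a              ∎
      where open ≡-Reasoning

    telescope : ∀ a b c → (a - b) + (b - c) ≡ a - c
    telescope a b c = begin
      (a - b) + (b - c)  ≡⟨ ℚP.+-assoc (a - b) b (- c) ⟨
      (a - b) + b - c    ≡⟨ cong (_- c) (a-b+b≡a a b) ⟩
      a - c              ∎
      where open ≡-Reasoning

    neg-minus : ∀ a b → - (a - b) ≡ b - a
    neg-minus a b = begin
      - (a - b)      ≡⟨ ℚP.neg-distrib-+ a (- b) ⟩
      - a + - (- b)  ≡⟨ cong (- a +_) (⁻¹-involutive b) ⟩
      - a + b        ≡⟨ ℚP.+-comm (- a) b ⟩
      b - a          ∎
      where open ≡-Reasoning

    plus-minus : ∀ a b c d → (a - b) + (c - d) ≡ (a + c) - (b + d)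
    plus-minus a b c d = trans (interchange a (- b) c (- d))
      (cong ((a + c) +_) (sym (ℚP.neg-distrib-+ b d)))

    times-minus : ∀ a b d → a * (b - d) ≡ a * b - a * d
    times-minus a b d = trans (ℚP.*-distribˡ-+ a b (- d))
      (cong (a * b +_) (sym (ℚP.neg-distribʳ-* a d)))

    product-split : ∀ a b c d → a * (b - d) + d * (a - c) ≡ a * b - c * d
    product-split a b c d = begin
      a * (b - d) + d * (a - c)
        ≡⟨ cong₂ _+_ (times-minus a b d) (times-minus d a c) ⟩
      (a * b - a * d) + (d * a - d * c)
        ≡⟨ cong₂ (λ u v → (a * b - a * d) + (u - v)) (ℚP.*-comm d a) (ℚP.*-comm d c) ⟩
      (a * b - a * d) + (a * d - c * d)
        ≡⟨ telescope (a * b) (a * d) (c * d) ⟩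
      a * b - c * d
        ∎
      where open ≡-Reasoning

    half-sum : ∀ ε → ½ * ε + ½ * ε ≡ ε
    half-sum ε = trans (sym (ℚP.*-distribʳ-+ ε ½ ½)) (ℚP.*-identityˡ ε)

    half-pos : ∀ {ε} → 0ℚ <ᵣ ε → 0ℚ <ᵣ ½ * ε
    half-pos {ε} 0<ε = subst (_<ᵣ ½ * ε) (ℚP.*-zeroʳ ½) (ℚP.*-monoʳ-<-pos ½ 0<ε)

    add-halves : ∀ {a b ε} → a <ᵣ ½ * ε → b <ᵣ ½ * ε → a + b <ᵣ ε
    add-halves {a} {b} {ε} p q = subst (a + b <ᵣ_) (half-sum ε) (ℚP.+-mono-< p q)

    dist-self : ∀ {a b ε} → a ≡ b → 0ℚ <ᵣ ε → ∣ a - b ∣ <ᵣ ε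
    dist-self {a} {_} {ε} refl = subst (_<ᵣ ε) (sym (cong ∣_∣ (ℚP.+-inverseʳ a)))

    dist-neg : ∀ a b → ∣ a - b ∣ ≡ ∣ (- a) - (- b) ∣
    dist-neg a b = trans (sym (ℚP.∣-p∣≡∣p∣ (a - b)))
      (cong ∣_∣ (ℚP.neg-distrib-+ a (- b)))

    dist-sym : ∀ a b → ∣ a - b ∣ ≡ ∣ b - a ∣
    dist-sym a b = trans (sym (ℚP.∣-p∣≡∣p∣ (a - b)))
      (cong ∣_∣ (neg-minus a b))

    dist-split : ∀ {c a b ε} → a + b ≡ c →
      ∣ a ∣ <ᵣ ½ * ε → ∣ b ∣ <ᵣ ½ * ε → ∣ c ∣ <ᵣ ε
    dist-split {_} {a} {b} refl p q =
      ℚP.≤-<-trans (ℚP.∣p+q∣≤∣p∣+∣q∣ a b) (add-halves p q)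

    dist-trans : ∀ {a b c ε} →
      ∣ a - b ∣ <ᵣ ½ * ε → ∣ b - c ∣ <ᵣ ½ * ε → ∣ a - c ∣ <ᵣ ε
    dist-trans {a} {b} {c} = dist-split {a = a - b} {b = b - c}
      (telescope a b c)

    dist-+ : ∀ {a b c d ε} →
      ∣ a - b ∣ <ᵣ ½ * ε → ∣ c - d ∣ <ᵣ ½ * ε → ∣ (a + c) - (b + d) ∣ <ᵣ ε
    dist-+ {a} {b} {c} {d} = dist-split {a = a - b} {b = c - d}
      (plus-minus a b c d)

    small-* : ∀ {K δ ε a x} → 0ℚ <ᵣ K → K * δ ≡ ½ * ε →
      ∣ a ∣ <ᵣ K → ∣ x ∣ <ᵣ δ → ∣ a * x ∣ <ᵣ ½ * ε
    small-* {K} {δ} {ε} {a} {x} 0<K Kδ p q = begin-strict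
      ∣ a * x ∣      ≡⟨ ℚP.∣p*q∣≡∣p∣*∣q∣ a x ⟩
      ∣ a ∣ * ∣ x ∣  ≤⟨ ℚP.*-monoʳ-≤-nonNeg ∣ x ∣ {{ℚP.∣-∣-nonNeg x}} (ℚP.<⇒≤ p) ⟩
      K * ∣ x ∣      <⟨ ℚP.*-monoʳ-<-pos K {{ℚ.positive 0<K}} q ⟩
      K * δ          ≡⟨ Kδ ⟩
      ½ * ε          ∎
      where open ℚP.≤-Reasoning

    dist-* : ∀ {K δ ε a b c d} → 0ℚ <ᵣ K → K * δ ≡ ½ * ε →
      ∣ a ∣ <ᵣ K → ∣ d ∣ <ᵣ K →
      ∣ a - c ∣ <ᵣ δ → ∣ b - d ∣ <ᵣ δ → ∣ (a * b) - (c * d) ∣ <ᵣ ε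
    dist-* {K} {δ} {ε} {a} {b} {c} {d} 0<K Kδ p q r s =
      dist-split {a = a * (b - d)} {b = d * (a - c)}
        (product-split a b c d)
        (small-* {K} {δ} {ε} {a} {b - d} 0<K Kδ p s)
        (small-* {K} {δ} {ε} {d} {a - c} 0<K Kδ q r)

    shrink : ∀ {K ε} → 0ℚ <ᵣ K → 0ℚ <ᵣ ε → ∃[ δ ] (0ℚ <ᵣ δ × K * δ ≡ ½ * ε)
    shrink {K} {ε} 0<K 0<ε = (ℚ.1/ K) * (½ * ε) , 0<δ ,
      trans (sym (ℚP.*-assoc K (ℚ.1/ K) (½ * ε)))
        (trans (cong (_* (½ * ε)) (ℚP.*-inverseʳ K)) (ℚP.*-identityˡ (½ * ε)))
      where
      instance
        K-pos = ℚ.positive 0<K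
        K-nonZero = ℚP.pos⇒nonZero K
        K⁻¹-pos = ℚP.1/pos⇒pos K
      0<δ : 0ℚ <ᵣ (ℚ.1/ K) * (½ * ε)
      0<δ = subst (_<ᵣ (ℚ.1/ K) * (½ * ε)) (ℚP.*-zeroʳ (ℚ.1/ K))
              (ℚP.*-monoʳ-<-pos (ℚ.1/ K) (half-pos 0<ε))

    0<1 : 0ℚ <ᵣ 1ℚ
    0<1 = ℚP.positive⁻¹ 1ℚ

    bounded : ∀ x → Cauchy x → ∃[ K ] (0ℚ <ᵣ K × ∃[ N ] ∀ n → N ℕ.≤ n → ∣ x n ∣ <ᵣ K)
    bounded x cx with cx 1ℚ 0<1
    ... | N , h = ∣ x N ∣ + 1ℚ , ℚP.+-mono-≤-< (ℚP.0≤∣p∣ (x N)) 0<1 , N , λ n N≤n →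
      ℚP.≤-<-trans
        (subst (λ z → ∣ z ∣ ≤ᵣ ∣ x N ∣ + ∣ x n - x N ∣)
          (trans (ℚP.+-comm (x N) (x n - x N)) (a-b+b≡a (x n) (x N)))
          (ℚP.∣p+q∣≤∣p∣+∣q∣ (x N) (x n - x N)))
        (ℚP.+-monoʳ-< ∣ x N ∣ (h n N N≤n ℕP.≤-refl))

    bounded₂ : ∀ x y → Cauchy x → Cauchy y →
      ∃[ K ] (0ℚ <ᵣ K × ∃[ N ] ∀ m n → N ℕ.≤ m → N ℕ.≤ n → (∣ x m ∣ <ᵣ K × ∣ y n ∣ <ᵣ K))
    bounded₂ x y cx cy with bounded x cx | bounded y cy
    ... | A , 0<A , M , hx | B , 0<B , N , hy =
      A + B , ℚP.+-mono-< 0<A 0<B , M ℕ.⊔ N , λ m n m≥ n≥ →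
        ℚP.<-≤-trans (hx m (ℕP.m⊔n≤o⇒m≤o M N m≥))
          (subst (_≤ᵣ A + B) (ℚP.+-identityʳ A) (ℚP.+-monoʳ-≤ A (ℚP.<⇒≤ 0<B))) ,
        ℚP.<-≤-trans (hy n (ℕP.m⊔n≤o⇒n≤o M N n≥))
          (subst (_≤ᵣ A + B) (ℚP.+-identityˡ B) (ℚP.+-monoˡ-≤ B (ℚP.<⇒≤ 0<A)))

infixl 6 _+_ _-_
infixl 7 _*_
infix  8 -_

fromℚ : ℚ → ℝ
fromℚ q = mkℝ (λ _ → q) (λ _ 0<ε → 0 , λ _ _ _ _ → dist-self {q} refl 0<ε)

0ℝ 1ℝ : ℝ
0ℝ = fromℚ 0ℚ
1ℝ = fromℚ 1ℚ

opaque
  -_ : ℝ → ℝ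
  - x = mkℝ (λ n → ℚ.- seq x n) λ ε 0<ε → let N , h = cauchy x ε 0<ε in
    N , λ m n m≥ n≥ → subst (ℚ._< ε) (dist-neg (seq x m) (seq x n)) (h m n m≥ n≥)

  _+_ : ℝ → ℝ → ℝ
  x + y = mkℝ (λ n → seq x n ℚ.+ seq y n) λ ε 0<ε →
    let M , h = cauchy x (½ ℚ.* ε) (half-pos 0<ε)
        N , k = cauchy y (½ ℚ.* ε) (half-pos 0<ε)
    in M ℕ.⊔ N , λ m n m≥ n≥ →
       dist-+ {seq x m} {seq x n} {seq y m} {seq y n}
         (h m n (ℕP.m⊔n≤o⇒m≤o M N m≥) (ℕP.m⊔n≤o⇒m≤o M N n≥))
         (k m n (ℕP.m⊔n≤o⇒n≤o M N m≥) (ℕP.m⊔n≤o⇒n≤o M N n≥))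

  _*_ : ℝ → ℝ → ℝ
  x * y = mkℝ (λ n → seq x n ℚ.* seq y n) λ ε 0<ε →
    let K , 0<K , L , b = bounded₂ (seq x) (seq y) (cauchy x) (cauchy y)
        δ , 0<δ , Kδ    = shrink 0<K 0<ε
        M , h = cauchy x δ 0<δ
        N , k = cauchy y δ 0<δ
    in L ℕ.⊔ (M ℕ.⊔ N) , λ m n m≥ n≥ →
       let m≥′ = ℕP.m⊔n≤o⇒n≤o L (M ℕ.⊔ N) m≥
           n≥′ = ℕP.m⊔n≤o⇒n≤o L (M ℕ.⊔ N) n≥
           p , q = b m n (ℕP.m⊔n≤o⇒m≤o L (M ℕ.⊔ N) m≥) (ℕP.m⊔n≤o⇒m≤o L (M ℕ.⊔ N) n≥)
       in dist-* {a = seq x m} {seq y m} {seq x n} {seq y n} 0<K Kδ p q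
            (h m n (ℕP.m⊔n≤o⇒m≤o M N m≥′) (ℕP.m⊔n≤o⇒m≤o M N n≥′))
            (k m n (ℕP.m⊔n≤o⇒n≤o M N m≥′) (ℕP.m⊔n≤o⇒n≤o M N n≥′))

_-_ : ℝ → ℝ → ℝ
x - y = x + - y

private
  pointwise : ∀ {x y} → (∀ n → seq x n ≡ seq y n) → x ≈ y
  pointwise {x} e = mk≈ λ ε 0<ε → 0 , λ n _ → dist-self {seq x n} (e n) 0<ε

  ≈-refl : ∀ {x} → x ≈ x
  ≈-refl = pointwise λ _ → refl

  ≈-sym : ∀ {x y} → x ≈ y → y ≈ x
  ≈-sym {x} {y} p = mk≈ λ ε 0<ε → let N , h = close p ε 0<ε in
    N , λ n n≥ → subst (ℚ._< ε) (dist-sym (seq x n) (seq y n)) (h n n≥)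

  ≈-trans : ∀ {x y z} → x ≈ y → y ≈ z → x ≈ z
  ≈-trans {x} {y} {z} p q = mk≈ λ ε 0<ε →
    let M , h = close p (½ ℚ.* ε) (half-pos 0<ε)
        N , k = close q (½ ℚ.* ε) (half-pos 0<ε)
    in M ℕ.⊔ N , λ n n≥ → dist-trans {seq x n} {seq y n} {seq z n}
         (h n (ℕP.m⊔n≤o⇒m≤o M N n≥)) (k n (ℕP.m⊔n≤o⇒n≤o M N n≥))

private opaque
  unfolding -_ _+_ _*_

  -‿cong : ∀ {x y} → x ≈ y → - x ≈ - y
  -‿cong {x} {y} p = mk≈ λ ε 0<ε → let N , h = close p ε 0<ε in
    N , λ n n≥ → subst (ℚ._< ε) (dist-neg (seq x n) (seq y n)) (h n n≥)

  +-cong : ∀ {x y u v} → x ≈ y → u ≈ v → x + u ≈ y + v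
  +-cong {x} {y} {u} {v} p q = mk≈ λ ε 0<ε →
    let M , h = close p (½ ℚ.* ε) (half-pos 0<ε)
        N , k = close q (½ ℚ.* ε) (half-pos 0<ε)
    in M ℕ.⊔ N , λ n n≥ → dist-+ {seq x n} {seq y n} {seq u n} {seq v n}
         (h n (ℕP.m⊔n≤o⇒m≤o M N n≥)) (k n (ℕP.m⊔n≤o⇒n≤o M N n≥))

  *-cong : ∀ {x y u v} → x ≈ y → u ≈ v → x * u ≈ y * v
  *-cong {x} {y} {u} {v} p q = mk≈ λ ε 0<ε →
    let K , 0<K , L , b = bounded₂ (seq x) (seq v) (cauchy x) (cauchy v)
        δ , 0<δ , Kδ    = shrink 0<K 0<ε
        M , h = close p δ 0<δ
        N , k = close q δ 0<δ
    in L ℕ.⊔ (M ℕ.⊔ N) , λ n n≥ →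
       let n≥′ = ℕP.m⊔n≤o⇒n≤o L (M ℕ.⊔ N) n≥
           n≥″ = ℕP.m⊔n≤o⇒m≤o L (M ℕ.⊔ N) n≥
           r , s = b n n n≥″ n≥″
       in dist-* {a = seq x n} {seq u n} {seq y n} {seq v n} 0<K Kδ r s
            (h n (ℕP.m⊔n≤o⇒m≤o M N n≥′)) (k n (ℕP.m⊔n≤o⇒n≤o M N n≥′))

  +-assoc : ∀ x y z → (x + y) + z ≈ x + (y + z)
  +-assoc x y z = pointwise λ n → ℚP.+-assoc (seq x n) (seq y n) (seq z n)

  +-comm : ∀ x y → x + y ≈ y + x
  +-comm x y = pointwise λ n → ℚP.+-comm (seq x n) (seq y n)

  +-identityˡ : ∀ x → 0ℝ + x ≈ x
  +-identityˡ x = pointwise λ n → ℚP.+-identityˡ (seq x n)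

  +-identityʳ : ∀ x → x + 0ℝ ≈ x
  +-identityʳ x = pointwise λ n → ℚP.+-identityʳ (seq x n)

  -‿inverseˡ : ∀ x → (- x) + x ≈ 0ℝ
  -‿inverseˡ x = pointwise λ n → ℚP.+-inverseˡ (seq x n)

  -‿inverseʳ : ∀ x → x + - x ≈ 0ℝ
  -‿inverseʳ x = pointwise λ n → ℚP.+-inverseʳ (seq x n)

  *-assoc : ∀ x y z → (x * y) * z ≈ x * (y * z)
  *-assoc x y z = pointwise λ n → ℚP.*-assoc (seq x n) (seq y n) (seq z n)

  *-comm : ∀ x y → x * y ≈ y * x
  *-comm x y = pointwise λ n → ℚP.*-comm (seq x n) (seq y n)

  *-identityˡ : ∀ x → 1ℝ * x ≈ x
  *-identityˡ x = pointwise λ n → ℚP.*-identityˡ (seq x n)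

  *-identityʳ : ∀ x → x * 1ℝ ≈ x
  *-identityʳ x = pointwise λ n → ℚP.*-identityʳ (seq x n)

  *-distribˡ-+ : ∀ x y z → x * (y + z) ≈ x * y + x * z
  *-distribˡ-+ x y z = pointwise λ n → ℚP.*-distribˡ-+ (seq x n) (seq y n) (seq z n)

  *-distribʳ-+ : ∀ x y z → (y + z) * x ≈ y * x + z * x
  *-distribʳ-+ x y z = pointwise λ n → ℚP.*-distribʳ-+ (seq x n) (seq y n) (seq z n)

ℝ-commutativeRing : CommutativeRing 0ℓ 0ℓ
ℝ-commutativeRing = record
  { Carrier = ℝ ; _≈_ = _≈_ ; _+_ = _+_ ; _*_ = _*_ ; -_ = -_ ; 0# = 0ℝ ; 1# = 1ℝ
  ; isCommutativeRing = record
    { isRing = record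
      { +-isAbelianGroup = record
        { isGroup = record
          { isMonoid = record
            { isSemigroup = record
              { isMagma = record
                { isEquivalence = record { refl = ≈-refl ; sym = ≈-sym ; trans = ≈-trans }
                ; ∙-cong = +-cong }
              ; assoc = +-assoc }
            ; identity = +-identityˡ , +-identityʳ }
          ; inverse = -‿inverseˡ , -‿inverseʳ
          ; ⁻¹-cong = -‿cong }
        ; comm = +-comm }
      ; *-cong = *-cong
      ; *-assoc = *-assoc
      ; *-identity = *-identityˡ , *-identityʳ
      ; distrib = *-distribˡ-+ , *-distribʳ-+ }
    ; *-comm = *-comm } }

ℝ² : Set
ℝ² = ℝ × ℝ

infix  4 _≈₂_
infixl 6 _+₂_ _-₂_
infixl 7 _·_

_≈₂_ : ℝ² → ℝ² → Set
(a , b) ≈₂ (c , d) = (a ≈ c) × (b ≈ d)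

_+₂_ _-₂_ : ℝ² → ℝ² → ℝ²
(a , b) +₂ (c , d) = a + c , b + d
(a , b) -₂ (c , d) = a - c , b - d

_·_ : ℝ → ℝ² → ℝ²
r · (a , b) = r * a , r * b

0₂ : ℝ²
0₂ = 0ℝ , 0ℝ

det : ℝ² → ℝ² → ℝ
det (a , b) (c , d) = a * d - b * c

sum₂ : List ℝ² → ℝ²
sum₂ = foldr _+₂_ 0₂

next : ∀ {n} → Fin (suc n) → Fin (suc n)
next {n} i = suc (toℕ i) mod suc n

-- The closed polygonal line through P 0, P 1, …, parametrised side by side
-- by half-open intervals [0, 1), is injective.  Coplanarity of the vertices,
-- the other half of flatness, is automatic in ℝ².
NonSelfIntersecting : ∀ {n} → (Fin (suc n) → ℝ²) → Set
NonSelfIntersecting {n} P = ∀ i j s t →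
  0ℝ ≤ s → s < 1ℝ → 0ℝ ≤ t → t < 1ℝ →
  point i s ≈₂ point j t → (i ≡ j) × (s ≈ t)
  where
  point : Fin (suc n) → ℝ → ℝ²
  point i s = P i +₂ s · (P (next i) -₂ P i)

-- Finite CW-complexes whose faces are polygons and whose 1-skeleton has no
-- loops or multiple edges.  Hence an edge is an unordered pair of vertices,
-- and a face is given by the cyclic sequence of its vertices; face f has
-- 3 + excess f of them.

record PolygonalComplex : Set where
  field
    #vertices #faces : ℕ
    excess           : Fin #faces → ℕ
    corner           : ∀ f → Fin (3 ℕ.+ excess f) → Fin #vertices
    corner-injective : ∀ f {i j} → corner f i ≡ corner f j → i ≡ j

  Vertex Face : Set
  Vertex = Fin #vertices
  Face   = Fin #faces

  Side : Face → Vertex → Vertex → Set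
  Side f p q = ∃[ i ] (corner f i ≡ p × corner f (next i) ≡ q)

  -- The boundary loop of f, oriented by the listing of its corners (pos) or
  -- against it (neg), runs along a side from p to q.
  Passes : Face → Sign → Vertex → Vertex → Set
  Passes f pos p q = Side f p q
  Passes f neg p q = Side f q p

  EdgeOf : Face → Vertex → Vertex → Set
  EdgeOf f p q = Side f p q ⊎ Side f q p

  CornerOf : Face → Vertex → Set
  CornerOf f v = ∃[ i ] corner f i ≡ v

  -- In a surface every edge belongs to some face.
  Adjacent : Vertex → Vertex → Set
  Adjacent p q = ∃[ f ] EdgeOf f p q

  adjacent? : ∀ p q → Dec (Adjacent p q)
  adjacent? p q = any? λ f → side? f p q ⊎-dec side? f q p
    where
    side? : ∀ f p q → Dec (Side f p q)
    side? f p q = any? λ i → (corner f i ≟ p) ×-dec (corner f (next i) ≟ q)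

  neighbours : Vertex → List Vertex
  neighbours p = filter (adjacent? p) (allFin #vertices)

-- The link of v is the graph whose nodes are the edges at v and whose arcs are
-- the faces at v, each joining its two edges at v.  By edge-surface its degrees
-- are at most 2, so with link-connected it is a cycle or a path: v has a disc
-- or a half-disc as a neighbourhood.
record IsSurface (C : PolygonalComplex) : Set where
  open PolygonalComplex C
  field
    covered        : ∀ v → ∃[ f ] CornerOf f v
    edge-surface   : ∀ p q f g h → EdgeOf f p q → EdgeOf g p q → EdgeOf h p q →
                     f ≡ g ⊎ g ≡ h ⊎ f ≡ h
    link-connected : ∀ v f g → CornerOf f v → CornerOf g v →
                     Star (λ a b → ∃[ u ] (EdgeOf a v u × EdgeOf b v u)) f g
    connected      : ∀ p q → Star Adjacent p q

record PolygonalSurface : Set where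
  field
    complex   : PolygonalComplex
    isSurface : IsSurface complex

  open PolygonalComplex complex public

  field
    position : Vertex → ℝ²
    flat     : ∀ f → NonSelfIntersecting (position ∘ corner f)

module _ (S : PolygonalSurface) where
  open PolygonalSurface S

  -- Values at pairs that are not edges are irrelevant.
  record Stress : Set where
    field
      weight    : Vertex → Vertex → ℝ
      symmetric : ∀ p q → Adjacent p q → weight p q ≈ weight q p

  open Stress

  IsSelfStress : Stress → Set
  IsSelfStress w = ∀ v →
    sum₂ (map (λ u → weight w v u · (position v -₂ position u)) (neighbours v)) ≈₂ 0₂

  OrientedFace : Set
  OrientedFace = Face × Sign

  -- A step of an oriented face-path through the edge pq, oriented from p to q
  -- by the face it leaves.
  data Step : OrientedFace → OrientedFace → Set where
    cross : ∀ {f g o o′} p q → .(f ≢ g) →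
            Passes f o p q → Passes g o′ q p → Step (f , o) (g , o′)
    stay  : ∀ {f o} p q → Passes f o p q → Step (f , o) (f , o)

  OrientedFacePath : OrientedFace → OrientedFace → Set
  OrientedFacePath = TransClosure Step

  edge : ∀ {x y} → Step x y → Vertex × Vertex
  edge (cross p q _ _ _) = p , q
  edge (stay p q _)      = p , q

  ρ : Face → Face → ℝ
  ρ f g = if does (f ≟ g) then 0ℝ else 1ℝ

  elementaryLift : Stress → ∀ {x y} → Step x y → ℝ² → ℝ
  elementaryLift w {f , _} {g , _} s P =
    det (position p -₂ position q) (position p -₂ P) * weight w p q * ρ f g
    where
    p = proj₁ (edge s)
    q = proj₂ (edge s)

  lift : ∀ {x y} → OrientedFacePath x y → Stress → ℝ² → ℝ
  lift [ s ]   w P = elementaryLift w s P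
  lift (s ∷ γ) w P = elementaryLift w s P + lift γ w P

  infix 4 _≈ₑ_ _∈ₑ_

  _≈ₑ_ : Vertex × Vertex → Vertex × Vertex → Set
  (p , q) ≈ₑ (p′ , q′) = (p ≡ p′ × q ≡ q′) ⊎ (p ≡ q′ × q ≡ p′)

  _∈ₑ_ : Vertex → Vertex × Vertex → Set
  v ∈ₑ (p , q) = v ≡ p ⊎ v ≡ q

  edges : ∀ {x y} → OrientedFacePath x y → List (Vertex × Vertex)
  edges [ s ]   = edge s ∷ []
  edges (s ∷ γ) = edge s ∷ edges γ

  faces : ∀ {x y} → OrientedFacePath x y → List Face
  faces {x} {y} [ _ ]   = proj₁ x ∷ proj₁ y ∷ []
  faces {x}     (_ ∷ γ) = proj₁ x ∷ faces γ

  -- δ = (g₁, …, gₖ) lists all the faces around the endpoint v of e in cyclic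
  -- order, e being the edge between gₖ and g₁.  That e belongs to both of them
  -- is not repeated here: the two steps through e in `around` below imply it.
  record Around (v : Vertex) (e : Vertex × Vertex) {x y} (δ : OrientedFacePath x y) : Set where
    field
      endpoint       : v ∈ₑ e
      edges-at-v     : All (v ∈ₑ_) (edges δ)
      edges-distinct : AllPairs (λ a b → ¬ (a ≈ₑ b)) (e ∷ edges δ)
      faces-distinct : Unique (faces δ)
      all-faces      : ∀ g → CornerOf g v → g ∈ faces δ

  data Insertion {x y} (s : Step x y) : OrientedFacePath x y → Set where
    double : ∀ {z} (s₁ : Step x z) (t : Step z z) (s₂ : Step z y) →
             edge s₁ ≈ₑ edge s → edge s₂ ≈ₑ edge s →
             Insertion s (s₁ ∷ t ∷ [ s₂ ])
    around : ∀ {z z′} v (s₁ : Step x z) (δ : OrientedFacePath z z′) (s₂ : Step z′ y) →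
             edge s₁ ≈ₑ edge s → edge s₂ ≈ₑ edge s → Around v (edge s) δ →
             Insertion s (s₁ ∷ (δ ∷ʳ s₂))

  data Move : ∀ {x y} → OrientedFacePath x y → OrientedFacePath x y → Set where
    only  : ∀ {x y} {s : Step x y} {δ} → Insertion s δ → Move [ s ] δ
    here  : ∀ {x y z} {s : Step x y} {δ} {γ : OrientedFacePath y z} →
            Insertion s δ → Move (s ∷ γ) (δ ++ γ)
    there : ∀ {x y z} {s : Step x y} {γ γ′ : OrientedFacePath y z} →
            Move γ γ′ → Move (s ∷ γ) (s ∷ γ′)

  Homotopic : ∀ {x y} → OrientedFacePath x y → OrientedFacePath x y → Set
  Homotopic = EqClosure Move

{-# OPTIONS --safe #-}
-- A step through the edge pq into another face contributes
-- jump p q = det(p - q, p - P) · w(pq), and jump q p = - jump p q; staying in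
-- the same face contributes 0.  Inserting a double face is therefore harmless:
-- an edge borders at most two faces, so crossings of it alternate in direction
-- and cancel.  A loop around v, inserted at an edge e, crosses each edge at v
-- other than e once, all in the same direction relative to v, because a face has just
-- two edges at v and orientations agree.  By the self-stress condition at v
-- the jumps of all edges at v add up to det(0, v - P) = 0, so the inner part of
-- the loop is worth minus the jump of e, which is compensated by its two
-- end steps.
module Submission where

open import Defs
open import Data.Sign.Base using (Sign)
open import Data.Product.Base using (_,_)

open import Algebra.Bundles using (CommutativeRing)
import Algebra.Properties.CommutativeSemigroup as CommutativeSemigroupProperties
import Algebra.Properties.Ring as RingProperties
open import Data.Empty using (⊥-elim; ⊥-elim-irr)
open import Data.Fin.Base using (Fin; toℕ)
open import Data.Fin.Properties using (_≟_; toℕ-injective; toℕ-fromℕ<; toℕ≤pred[n])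
open import Data.List.Base using (List; []; _∷_; foldr; map; allFin)
open import Data.List.Membership.Propositional using (_∈_)
open import Data.List.Membership.Propositional.Properties
  using (∈-filter⁺; ∈-filter⁻; ∈-allFin)
open import Data.List.Membership.Propositional.Properties.WithK using (unique∧set⇒bag)
open import Data.List.Relation.Binary.BagAndSetEquality using (∼bag⇒↭)
open import Data.List.Relation.Binary.Permutation.Propositional using (_↭_; ↭⇒↭ₛ)
import Data.List.Relation.Binary.Permutation.Setoid.Properties as PermutationProperties
open import Data.List.Relation.Unary.All as All using (All; []; _∷_)
open import Data.List.Relation.Unary.AllPairs as AllPairs using (AllPairs; []; _∷_)
import Data.List.Relation.Unary.AllPairs.Properties as AllPairsP
open import Data.List.Relation.Unary.Any using (here; there)
open import Data.List.Relation.Unary.Unique.Propositional using (Unique)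
import Data.List.Relation.Unary.Unique.Propositional.Properties as UniqueP
open import Data.Nat.Base as ℕ using (suc)
open import Data.Nat.DivMod using (_%_; m<n⇒m%n≡m; n%n≡0)
import Data.Nat.Properties as ℕP
open import Data.Product.Base using (∃-syntax; _×_; proj₁; proj₂)
open import Data.Sign.Base using (opposite) renaming (+ to pos; - to neg)
open import Data.Sum.Base using (_⊎_; inj₁; inj₂)
open import Function.Base using (_∘_)
open import Function.Bundles using (mk⇔)
open import Relation.Binary.Construct.Closure.Equivalence using (gfold)
open import Relation.Binary.Construct.Closure.Transitive
  using ([_]; _∷_; _++_; _∷ʳ_)
open import Relation.Binary.PropositionalEquality as ≡
  using (_≡_; _≢_; refl; cong; subst)
import Relation.Binary.Reasoning.Setoid as SetoidReasoning
open import Relation.Nullary using (¬_; yes; no)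

private
  module ℛ = CommutativeRing ℝ-commutativeRing
  module ℛP = RingProperties ℛ.ring

open CommutativeSemigroupProperties ℛ.+-commutativeSemigroup using (interchange)
open SetoidReasoning ℛ.setoid

-- Finite sums of reals.

∑ : {A : Set} → (A → ℝ) → List A → ℝ
∑ f as = foldr _+_ 0ℝ (map f as)

-- Lets the edges at a vertex be summed either in the order in which a loop crosses them or in the
-- order of `neighbours`.
∑-↭ : {A : Set} (f : A → ℝ) {as bs : List A} → as ↭ bs → ∑ f as ≈ ∑ f bs
∑-↭ f as↭bs = PermutationProperties.foldr-commMonoid ℛ.setoid ℛ.+-isCommutativeMonoid
  (PermutationProperties.map⁺ (≡.setoid _) ℛ.setoid (ℛ.reflexive ∘ cong f) (↭⇒↭ₛ as↭bs))

∑-neg : {A : Set} (f : A → ℝ) (as : List A) → ∑ (λ a → - f a) as ≈ - ∑ f as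
∑-neg f []       = ℛ.sym ℛP.-0#≈0#
∑-neg f (a ∷ as) = ℛ.trans (ℛ.+-congˡ (∑-neg f as)) (ℛP.-‿+-comm (f a) (∑ f as))

minus-telescope : ∀ a b c → (a - b) + (b - c) ≈ a - c
minus-telescope a b c = begin
  (a - b) + (b - c)    ≈⟨ ℛ.+-assoc a (- b) (b - c) ⟩
  a + (- b + (b - c))  ≈⟨ ℛ.+-congˡ (ℛ.+-assoc (- b) b (- c)) ⟨
  a + (- b + b - c)    ≈⟨ ℛ.+-congˡ (ℛ.+-congʳ (ℛ.-‿inverseˡ b)) ⟩
  a + (0ℝ - c)         ≈⟨ ℛ.+-congˡ (ℛ.+-identityˡ (- c)) ⟩
  a - c                ∎

-- Determinants in the plane.

det-cong : ∀ {u u′ w w′} → u ≈₂ u′ → w ≈₂ w′ → det u w ≈ det u′ w′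
det-cong (a , b) (c , d) = ℛ.+-cong (ℛ.*-cong a d) (ℛ.-‿cong (ℛ.*-cong b c))

det-+ˡ : ∀ u u′ w → det (u +₂ u′) w ≈ det u w + det u′ w
det-+ˡ (a , b) (a′ , b′) (c , d) = begin
  (a + a′) * d - (b + b′) * c
    ≈⟨ ℛ.+-cong (ℛ.distribʳ d a a′) (ℛ.-‿cong (ℛ.distribʳ c b b′)) ⟩
  (a * d + a′ * d) - (b * c + b′ * c)
    ≈⟨ ℛ.+-congˡ (ℛP.-‿+-comm (b * c) (b′ * c)) ⟨
  (a * d + a′ * d) + (- (b * c) + - (b′ * c))
    ≈⟨ interchange (a * d) (a′ * d) (- (b * c)) (- (b′ * c)) ⟩
  (a * d - b * c) + (a′ * d - b′ * c)
    ∎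

det-+ʳ : ∀ u w w′ → det u (w +₂ w′) ≈ det u w + det u w′
det-+ʳ (a , b) (c , d) (c′ , d′) = begin
  a * (d + d′) - b * (c + c′)
    ≈⟨ ℛ.+-cong (ℛ.distribˡ a d d′) (ℛ.-‿cong (ℛ.distribˡ b c c′)) ⟩
  (a * d + a * d′) - (b * c + b * c′)
    ≈⟨ ℛ.+-congˡ (ℛP.-‿+-comm (b * c) (b * c′)) ⟨
  (a * d + a * d′) + (- (b * c) + - (b * c′))
    ≈⟨ interchange (a * d) (a * d′) (- (b * c)) (- (b * c′)) ⟩
  (a * d - b * c) + (a * d′ - b * c′)
    ∎

det-·ˡ : ∀ r u w → det (r · u) w ≈ det u w * r
det-·ˡ r (a , b) (c , d) = begin
  r * a * d - r * b * c      ≈⟨ ℛ.+-cong (ℛ.*-assoc r a d) (ℛ.-‿cong (ℛ.*-assoc r b c)) ⟩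
  r * (a * d) - r * (b * c)  ≈⟨ ℛP.x[y-z]≈xy-xz r (a * d) (b * c) ⟨
  r * (a * d - b * c)        ≈⟨ ℛ.*-comm r (a * d - b * c) ⟩
  (a * d - b * c) * r        ∎

det-self : ∀ u → det u u ≈ 0ℝ
det-self (a , b) = ℛP.x≈y⇒x∙y⁻¹≈ε (ℛ.*-comm a b)

det-0ˡ : ∀ w → det 0₂ w ≈ 0ℝ
det-0ˡ (c , d) = ℛP.x≈y⇒x∙y⁻¹≈ε (ℛ.trans (ℛ.zeroˡ d) (ℛ.sym (ℛ.zeroˡ c)))

-- The second arguments `p -₂ P` and `q -₂ P` differ by the first argument `p -₂ q`, so a shear
-- exchanges them; after that only the sign of the first argument differs.
det-swap : ∀ p q P → det (q -₂ p) (q -₂ P) ≈ - det (p -₂ q) (p -₂ P)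
det-swap p q P = begin
  det (q -₂ p) (q -₂ P)    ≈⟨ ℛP.+-inverseˡ-unique _ _ cancel ⟩
  - det (p -₂ q) (q -₂ P)  ≈⟨ ℛ.-‿cong (ℛ.sym shear) ⟩
  - det (p -₂ q) (p -₂ P)  ∎
  where
  -₂-telescope : ∀ a b c → (a -₂ b) +₂ (b -₂ c) ≈₂ a -₂ c
  -₂-telescope (a , a′) (b , b′) (c , c′) = minus-telescope a b c , minus-telescope a′ b′ c′

  cancel : det (q -₂ p) (q -₂ P) + det (p -₂ q) (q -₂ P) ≈ 0ℝ
  cancel = begin
    det (q -₂ p) (q -₂ P) + det (p -₂ q) (q -₂ P)
      ≈⟨ det-+ˡ (q -₂ p) (p -₂ q) (q -₂ P) ⟨
    det ((q -₂ p) +₂ (p -₂ q)) (q -₂ P)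
      ≈⟨ det-cong (-₂-telescope q p q) (ℛ.refl , ℛ.refl) ⟩
    det (q -₂ q) (q -₂ P)
      ≈⟨ det-cong (ℛ.-‿inverseʳ (proj₁ q) , ℛ.-‿inverseʳ (proj₂ q)) (ℛ.refl , ℛ.refl) ⟩
    det 0₂ (q -₂ P)
      ≈⟨ det-0ˡ (q -₂ P) ⟩
    0ℝ
      ∎

  shear : det (p -₂ q) (p -₂ P) ≈ det (p -₂ q) (q -₂ P)
  shear = begin
    det (p -₂ q) (p -₂ P)
      ≈⟨ det-cong (ℛ.refl , ℛ.refl) (-₂-telescope p q P) ⟨
    det (p -₂ q) ((p -₂ q) +₂ (q -₂ P))
      ≈⟨ det-+ʳ (p -₂ q) (p -₂ q) (q -₂ P) ⟩
    det (p -₂ q) (p -₂ q) + det (p -₂ q) (q -₂ P)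
      ≈⟨ ℛ.+-congʳ (det-self (p -₂ q)) ⟩
    0ℝ + det (p -₂ q) (q -₂ P)
      ≈⟨ ℛ.+-identityˡ _ ⟩
    det (p -₂ q) (q -₂ P)
      ∎

-- Linearity in the first argument; this turns the vector equation of a self-stress into a scalar
-- one.
det-sum₂ : {A : Set} (r : A → ℝ) (d : A → ℝ²) (z : ℝ²) (as : List A) →
  det (sum₂ (map (λ a → r a · d a) as)) z ≈ ∑ (λ a → det (d a) z * r a) as
det-sum₂ r d z []       = det-0ˡ z
det-sum₂ r d z (a ∷ as) =
  ℛ.trans (det-+ˡ _ _ z) (ℛ.+-cong (det-·ˡ (r a) (d a) z) (det-sum₂ r d z as))

-- The cyclic successor and the sides of a face.

toℕ-next : ∀ {n} (i : Fin (suc n)) →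
  toℕ (next i) ≡ suc (toℕ i) ⊎ (toℕ i ≡ n × toℕ (next i) ≡ 0)
toℕ-next {n} i with ℕP.m≤n⇒m<n∨m≡n (toℕ≤pred[n] i)
... | inj₁ i<n = inj₁ (≡.trans (toℕ-fromℕ< _) (m<n⇒m%n≡m (ℕ.s<s i<n)))
... | inj₂ i≡n = inj₂ (i≡n , ≡.trans (toℕ-fromℕ< _)
  (≡.trans (cong (λ k → suc k % suc n) i≡n) (n%n≡0 (suc n))))

next-injective : ∀ {n} (i j : Fin (suc n)) → next i ≡ next j → i ≡ j
next-injective i j eq with toℕ-next i | toℕ-next j | cong toℕ eq
... | inj₁ a       | inj₁ b       | e =
  toℕ-injective (ℕP.suc-injective (≡.trans (≡.sym a) (≡.trans e b)))
... | inj₁ a       | inj₂ (_ , b) | e with () ← ≡.trans (≡.sym a) (≡.trans e b)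
... | inj₂ (_ , a) | inj₁ b       | e with () ← ≡.trans (≡.sym b) (≡.trans (≡.sym e) a)
... | inj₂ (a , _) | inj₂ (b , _) | _ = toℕ-injective (≡.trans a (≡.sym b))

-- Depends on there being at least three indices: a wrap-around at either of the two shifts would
-- make the last index `2 + n` equal to 0 or 1.
next∘next≢id : ∀ {n} (i : Fin (3 ℕ.+ n)) → next (next i) ≢ i
next∘next≢id i eq with toℕ-next i | toℕ-next (next i) | cong toℕ eq
... | inj₁ a       | inj₁ b       | e =
  -- Without a wrap-around the index would equal itself plus 2, which is `1 + 1`.
  ℕP.m≢1+n+m (toℕ i) {1} (≡.trans (≡.sym e) (≡.trans b (cong suc a)))
... | inj₁ a       | inj₂ (b , c) | e
  with () ← ≡.trans (≡.sym b) (≡.trans a (cong suc (≡.trans (≡.sym e) c)))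
... | inj₂ (a , b) | inj₁ c       | e
  with () ← ≡.trans (≡.sym a) (≡.trans (≡.sym e) (≡.trans c (cong suc b)))
... | inj₂ (_ , a) | inj₂ (b , _) | _ with () ← ≡.trans (≡.sym a) b

module _ (C : PolygonalComplex) where
  open PolygonalComplex C

  side-target-unique : ∀ {f v u u′} → Side f v u → Side f v u′ → u ≡ u′
  side-target-unique {f} (_ , a , b) (_ , c , d)
    with refl ← corner-injective f (≡.trans a (≡.sym c)) = ≡.trans (≡.sym b) d

  side-source-unique : ∀ {f v u u′} → Side f u v → Side f u′ v → u ≡ u′
  side-source-unique {f} (i , a , b) (j , c , d)
    with refl ← next-injective i j (corner-injective f (≡.trans b (≡.sym d))) =
    ≡.trans (≡.sym a) c

  -- Corners do not repeat, so two opposite sides would return to the first corner after two shifts.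
  -- Hence an oriented face has one well-defined direction along each of its edges.
  side-asymmetric : ∀ {f p q} → Side f p q → ¬ Side f q p
  side-asymmetric {f} (i , a , b) (j , c , d)
    with refl ← corner-injective f (≡.trans b (≡.sym c)) =
    next∘next≢id i (corner-injective f (≡.trans d (≡.sym a)))

module _ (S : PolygonalSurface) where
  open PolygonalSurface S
  open IsSurface isSurface using (edge-surface)

  private
    infix 4 _≃_
    _≃_ : Vertex × Vertex → Vertex × Vertex → Set
    _≃_ = _≈ₑ_ S

    variable
      x y z : OrientedFace S
      v u u′ : Vertex

  -- Unoriented edges, and the direction in which an oriented face runs along them.

  ≃-sym : ∀ {a b} → a ≃ b → b ≃ a
  ≃-sym (inj₁ (refl , refl)) = inj₁ (refl , refl)
  ≃-sym (inj₂ (refl , refl)) = inj₂ (refl , refl)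

  ≃-trans : ∀ {a b c} → a ≃ b → b ≃ c → a ≃ c
  ≃-trans (inj₁ (refl , refl)) q                    = q
  ≃-trans (inj₂ (refl , refl)) (inj₁ (refl , refl)) = inj₂ (refl , refl)
  ≃-trans (inj₂ (refl , refl)) (inj₂ (refl , refl)) = inj₁ (refl , refl)

  opposite-end : ∀ {e} → _∈ₑ_ S v e → ∃[ u ] e ≃ (v , u)
  opposite-end {e = p , q} (inj₁ refl) = q , inj₁ (refl , refl)
  opposite-end {e = p , q} (inj₂ refl) = p , inj₂ (refl , refl)

  EdgeOf-resp-≃ : ∀ {f p q} → EdgeOf f p q → (p , q) ≃ (v , u) → EdgeOf f v u
  EdgeOf-resp-≃ e        (inj₁ (refl , refl)) = e
  EdgeOf-resp-≃ (inj₁ a) (inj₂ (refl , refl)) = inj₂ a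
  EdgeOf-resp-≃ (inj₂ a) (inj₂ (refl , refl)) = inj₁ a

  EdgeOf⇒CornerOf : ∀ {f} → EdgeOf f v u → CornerOf f v
  EdgeOf⇒CornerOf (inj₁ (i , a , _)) = i , a
  EdgeOf⇒CornerOf (inj₂ (i , _ , b)) = next i , b

  -- An edge borders at most two faces, so crossing it twice leads back to the start.
  shared-edge : ∀ {f g h} → EdgeOf f v u → EdgeOf g v u → EdgeOf h v u →
    f ≢ g → g ≢ h → f ≡ h
  shared-edge a b c f≢g g≢h with edge-surface _ _ _ _ _ a b c
  ... | inj₁ f≡g        = ⊥-elim (f≢g f≡g)
  ... | inj₂ (inj₁ g≡h) = ⊥-elim (g≢h g≡h)
  ... | inj₂ (inj₂ f≡h) = f≡h

  -- The sign says whether the edge vu is run away from v (pos) or towards v (neg).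
  dart : Sign → Vertex → Vertex → Vertex × Vertex
  dart pos v u = v , u
  dart neg v u = u , v

  Runs : Sign → OrientedFace S → Vertex → Vertex → Set
  Runs σ (f , o) v u = Passes f o (proj₁ (dart σ v u)) (proj₂ (dart σ v u))

  dart-≃ : ∀ σ → dart σ v u ≃ (v , u)
  dart-≃ pos = inj₁ (refl , refl)
  dart-≃ neg = inj₂ (refl , refl)

  -- The boundary loop of a face visits `v` at most once, so it has at most one side entering `v`
  -- and one leaving it; `σ` and the orientation together decide which of these is meant.
  Runs-unique : ∀ σ x → Runs σ x v u → Runs σ x v u′ → u ≡ u′
  Runs-unique pos (_ , pos) = side-target-unique complex
  Runs-unique pos (_ , neg) = side-source-unique complex
  Runs-unique neg (_ , pos) = side-source-unique complex
  Runs-unique neg (_ , neg) = side-target-unique complex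

  Runs-asymmetric : ∀ σ x → Runs σ x v u → ¬ Runs (opposite σ) x v u
  Runs-asymmetric pos (_ , pos) = side-asymmetric complex
  Runs-asymmetric pos (_ , neg) = side-asymmetric complex
  Runs-asymmetric neg (_ , pos) = side-asymmetric complex
  Runs-asymmetric neg (_ , neg) = side-asymmetric complex

  Runs-dichotomy : ∀ σ x → EdgeOf (proj₁ x) v u → Runs (opposite σ) x v u ⊎ Runs σ x v u
  Runs-dichotomy pos (_ , pos) (inj₁ a) = inj₂ a
  Runs-dichotomy pos (_ , pos) (inj₂ a) = inj₁ a
  Runs-dichotomy pos (_ , neg) (inj₁ a) = inj₁ a
  Runs-dichotomy pos (_ , neg) (inj₂ a) = inj₂ a
  Runs-dichotomy neg (_ , pos) (inj₁ a) = inj₁ a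
  Runs-dichotomy neg (_ , pos) (inj₂ a) = inj₂ a
  Runs-dichotomy neg (_ , neg) (inj₁ a) = inj₂ a
  Runs-dichotomy neg (_ , neg) (inj₂ a) = inj₁ a

  Runs-pos⇒EdgeOf : ∀ x → Runs pos x v u → EdgeOf (proj₁ x) v u
  Runs-pos⇒EdgeOf (_ , pos) = inj₁
  Runs-pos⇒EdgeOf (_ , neg) = inj₂

  Runs-neg⇒EdgeOf : ∀ x → Runs neg x v u → EdgeOf (proj₁ x) v u
  Runs-neg⇒EdgeOf (_ , pos) = inj₂
  Runs-neg⇒EdgeOf (_ , neg) = inj₁

  step-source : (s : Step S x y) → Runs pos x (proj₁ (edge S s)) (proj₂ (edge S s))
  step-source (cross _ _ _ a _) = a
  step-source (stay _ _ a)      = a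

  step-source-EdgeOf : (s : Step S x y) → edge S s ≃ (v , u) → EdgeOf (proj₁ x) v u
  step-source-EdgeOf s = EdgeOf-resp-≃ (Runs-pos⇒EdgeOf _ (step-source s))

  step-target-EdgeOf : (s : Step S x y) → edge S s ≃ (v , u) → EdgeOf (proj₁ y) v u
  step-target-EdgeOf (cross _ _ _ _ b) = EdgeOf-resp-≃ (Runs-neg⇒EdgeOf _ b)
  step-target-EdgeOf (stay _ _ a)      = EdgeOf-resp-≃ (Runs-pos⇒EdgeOf _ a)

  -- The edge of a step is written in the direction of the face it leaves, and that face has only
  -- one direction along it.
  edge≡dart : ∀ σ (s : Step S x y) → Runs σ x v u → edge S s ≃ (v , u) →
    edge S s ≡ dart σ v u
  edge≡dart pos s r (inj₁ (refl , refl)) = refl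
  edge≡dart pos s r (inj₂ (refl , refl)) = ⊥-elim (Runs-asymmetric pos _ r (step-source s))
  edge≡dart neg s r (inj₁ (refl , refl)) = ⊥-elim (Runs-asymmetric pos _ (step-source s) r)
  edge≡dart neg s r (inj₂ (refl , refl)) = refl

  last-face : (δ : OrientedFacePath S x y) → proj₁ y ∈ faces S δ
  last-face [ _ ]   = there (here refl)
  last-face (_ ∷ δ) = there (last-face δ)

  end-faces-distinct : (δ : OrientedFacePath S x y) → Unique (faces S δ) → proj₁ x ≢ proj₁ y
  end-faces-distinct [ _ ]   ((x≢y ∷ _) ∷ _) = x≢y
  end-faces-distinct (_ ∷ δ) (x∉ ∷ _)        = All.lookup x∉ (last-face δ)

  first-face : (δ : OrientedFacePath S x y) → proj₁ x ∈ faces S δ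
  first-face [ _ ]   = here refl
  first-face (_ ∷ _) = here refl

  neighbour⁺ : Adjacent v u → u ∈ neighbours v
  neighbour⁺ {v} {u} = ∈-filter⁺ (adjacent? v) (∈-allFin u)

  neighbour⁻ : u ∈ neighbours v → Adjacent v u
  neighbour⁻ {v = v} = proj₂ ∘ ∈-filter⁻ (adjacent? v) {xs = allFin #vertices}

  neighbours-unique : ∀ v → Unique (neighbours v)
  neighbours-unique v = UniqueP.filter⁺ (adjacent? v) (UniqueP.allFin⁺ #vertices)

  module _ (w : Stress S) (P : ℝ²) where
    open Stress w

    private
      L : Step S x y → ℝ
      L s = elementaryLift S w s P

      T : OrientedFacePath S x y → ℝ
      T γ = lift S γ w P

    -- Lifts in terms of jumps.

    jump : Vertex → Vertex → ℝ
    jump v u = det (position v -₂ position u) (position v -₂ P) * weight v u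

    -- The value of crossing `vu` along `dart σ v u`. It is based at `v` for both signs, so that the
    -- sums around `v` are those of the self-stress condition at `v`.
    signedJump : Sign → Vertex → Vertex → ℝ
    signedJump pos v u = jump v u
    signedJump neg v u = - jump v u

    jump-antisym : Adjacent v u → jump u v ≈ - jump v u
    jump-antisym {v} {u} a = ℛ.trans
      (ℛ.*-cong (det-swap (position v) (position u) P) (ℛ.sym (symmetric v u a)))
      (ℛ.sym (ℛP.-‿distribˡ-* _ _))

    signedJump-opposite : ∀ σ v u → signedJump (opposite σ) v u ≈ - signedJump σ v u
    signedJump-opposite pos v u = ℛ.refl
    signedJump-opposite neg v u = ℛ.sym (ℛP.-‿involutive (jump v u))

    lift-++ : (γ : OrientedFacePath S x y) (γ′ : OrientedFacePath S y z) →
      T (γ ++ γ′) ≈ T γ + T γ′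
    lift-++ [ s ]   γ′ = ℛ.refl
    lift-++ (s ∷ γ) γ′ = ℛ.trans (ℛ.+-congˡ (lift-++ γ γ′)) (ℛ.sym (ℛ.+-assoc _ _ _))

    lift-∷ʳ : (γ : OrientedFacePath S x y) (s : Step S y z) → T (γ ∷ʳ s) ≈ T γ + L s
    lift-∷ʳ [ _ ]   s = ℛ.refl
    lift-∷ʳ (_ ∷ γ) s = ℛ.trans (ℛ.+-congˡ (lift-∷ʳ γ s)) (ℛ.sym (ℛ.+-assoc _ _ _))

    same-face : (s : Step S x y) → proj₁ x ≡ proj₁ y → L s ≈ 0ℝ
    same-face {f , _} {g , _} s eq with f ≟ g
    ... | yes _  = ℛ.zeroʳ _
    ... | no f≢g = ⊥-elim (f≢g eq)

    other-face : (s : Step S x y) → proj₁ x ≢ proj₁ y →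
      L s ≈ jump (proj₁ (edge S s)) (proj₂ (edge S s))
    other-face {f , _} {g , _} s neq with f ≟ g
    ... | yes f≡g = ⊥-elim (neq f≡g)
    ... | no _    = ℛ.*-identityʳ _

    -- The two outcomes of a step through `vu` that leaves a face running the edge in direction `σ`.
    -- Later case distinctions match on this, with the value of the lift at hand.
    data Crossing (σ : Sign) (v u : Vertex) {x y} (s : Step S x y) : Set where
      stays   : x ≡ y → L s ≈ 0ℝ → Crossing σ v u s
      crosses : proj₁ x ≢ proj₁ y → Runs (opposite σ) y v u → L s ≈ signedJump σ v u →
                Crossing σ v u s

    jump-dart : ∀ σ → Adjacent v u →
      jump (proj₁ (dart σ v u)) (proj₂ (dart σ v u)) ≈ signedJump σ v u
    jump-dart pos a = ℛ.refl
    jump-dart neg a = jump-antisym a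

    crossing : ∀ σ (s : Step S x y) → Runs σ x v u → edge S s ≃ (v , u) → Crossing σ v u s
    crossing {x} σ s@(stay _ _ _) r e = stays refl (same-face s refl)
    crossing {x} {_} {v} {u} σ s@(cross {f} {g} {_} {o′} p q f≢g _ b) r e =
      crosses f≢g′ (target σ (edge≡dart σ s r e)) (begin
        L s        ≈⟨ other-face s f≢g′ ⟩
        jump p q   ≡⟨ cong (λ d → jump (proj₁ d) (proj₂ d)) (edge≡dart σ s r e) ⟩
        jump (proj₁ (dart σ v u)) (proj₂ (dart σ v u))
                   ≈⟨ jump-dart σ (f , step-source-EdgeOf s e) ⟩
        signedJump σ v u ∎)
      where
      -- The inequality stored in `cross` is irrelevant; it can be used because the goal is empty.
      f≢g′ : f ≢ g
      f≢g′ eq = ⊥-elim-irr (f≢g eq)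
      target : ∀ σ → (p , q) ≡ dart σ v u → Runs (opposite σ) (g , o′) v u
      target pos refl = b
      target neg refl = b

    -- Whether a step stays or crosses is decided by its end faces, which `s` and `s′` share.
    crossing-irrelevant : ∀ {σ} {s s′ : Step S x y} →
      Crossing σ v u s → Crossing σ v u s′ → L s ≈ L s′
    crossing-irrelevant (stays _ l)       (stays _ l′)     = ℛ.trans l (ℛ.sym l′)
    crossing-irrelevant (stays refl _)    (crosses a _ _)  = ⊥-elim (a refl)
    crossing-irrelevant (crosses a _ _)   (stays refl _)   = ⊥-elim (a refl)
    crossing-irrelevant (crosses _ _ l)   (crosses _ _ l′) = ℛ.trans l (ℛ.sym l′)

    -- Case analysis for the insertion of a double face and of a loop.

    double-invariant : {s : Step S x y} (s₁ : Step S x z) (t : Step S z z) (s₂ : Step S z y) →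
      edge S s₁ ≃ edge S s → edge S s₂ ≃ edge S s → L s ≈ T (s₁ ∷ t ∷ [ s₂ ])
    double-invariant {s = s} s₁ t s₂ e₁ e₂ = begin
      L s                  ≈⟨ two-steps ⟩
      L s₁ + L s₂          ≈⟨ ℛ.+-congˡ (ℛ.+-identityˡ (L s₂)) ⟨
      L s₁ + (0ℝ + L s₂)   ≈⟨ ℛ.+-congˡ (ℛ.+-congʳ (same-face t refl)) ⟨
      L s₁ + (L t + L s₂)  ∎
      where
      e : edge S s ≃ edge S s
      e = inj₁ (refl , refl)

      two-steps : L s ≈ L s₁ + L s₂
      two-steps with crossing pos s₁ (step-source s) e₁
      ... | stays refl l₁ = begin
        L s          ≈⟨ crossing-irrelevant (crossing pos s (step-source s) e)
                                            (crossing pos s₂ (step-source s) e₂) ⟩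
        L s₂         ≈⟨ ℛ.+-identityˡ (L s₂) ⟨
        0ℝ + L s₂    ≈⟨ ℛ.+-congʳ l₁ ⟨
        L s₁ + L s₂  ∎
      -- After `s₁` has crossed, `z` runs the edge backwards, so `s₂` is read with the sign `neg`.
      -- Then `s₂` either stays and `s₁` alone does the work of `s`, or returns to the face of `x`
      -- and cancels `s₁`.
      ... | crosses x≢z r l₁ with crossing neg s₂ r e₂ | crossing pos s (step-source s) e
      ...   | stays refl _   | stays refl _    = ⊥-elim (x≢z refl)
      ...   | stays refl l₂  | crosses _ _ l   = begin
        L s          ≈⟨ ℛ.trans l (ℛ.sym l₁) ⟩
        L s₁         ≈⟨ ℛ.+-identityʳ (L s₁) ⟨
        L s₁ + 0ℝ    ≈⟨ ℛ.+-congˡ l₂ ⟨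
        L s₁ + L s₂  ∎
      ...   | crosses _ _ l₂  | stays refl l   =
        ℛ.trans l (ℛ.sym (ℛ.trans (ℛ.+-cong l₁ l₂) (ℛ.-‿inverseʳ _)))
      ...   | crosses z≢y _ _ | crosses x≢y _ _ = ⊥-elim (x≢y (shared-edge
        (step-source-EdgeOf s e) (step-target-EdgeOf s₁ e₁) (step-target-EdgeOf s₂ e₂) x≢z z≢y))

    -- Here z and z′ hold the two faces along the edge vu, so x and y repeat them,
    -- and t stands for the lift of the loop from z to z′ around v.
    detour-towards : ∀ σ {x y z z′} (s : Step S x y) (s₁ : Step S x z) (s₂ : Step S z′ y) {t} →
      edge S s ≃ (v , u) → edge S s₁ ≃ (v , u) → edge S s₂ ≃ (v , u) →
      proj₁ z ≢ proj₁ z′ → Runs (opposite σ) z v u → t ≈ - signedJump σ v u →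
      Crossing (opposite σ) v u s₁ → Crossing σ v u s₂ → Crossing (opposite σ) v u s →
      L s ≈ L s₁ + (t + L s₂)
    -- A crossing `s₁` would make `z` run the edge against the direction given by `r`.
    detour-towards σ s s₁ s₂ e e₁ e₂ z≢z′ r l (crosses _ r′ _) _ _ =
      ⊥-elim (Runs-asymmetric (opposite σ) _ r r′)
    detour-towards σ s s₁ s₂ e e₁ e₂ z≢z′ r l (stays refl _) (stays refl _) (stays refl _) =
      ⊥-elim (z≢z′ refl)
    detour-towards {v} {u} σ s s₁ s₂ {t} e e₁ e₂ z≢z′ r l
      (stays refl l₁) (stays refl l₂) (crosses _ _ l₀) = begin
        L s                  ≈⟨ l₀ ⟩
        signedJump (opposite σ) v u  ≈⟨ signedJump-opposite σ v u ⟩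
        - signedJump σ v u   ≈⟨ l ⟨
        t                    ≈⟨ ℛ.+-identityʳ t ⟨
        t + 0ℝ               ≈⟨ ℛ.+-identityˡ (t + 0ℝ) ⟨
        0ℝ + (t + 0ℝ)        ≈⟨ ℛ.+-cong l₁ (ℛ.+-congˡ l₂) ⟨
        L s₁ + (t + L s₂)    ∎
    detour-towards {v} {u} σ s s₁ s₂ {t} e e₁ e₂ z≢z′ r l
      (stays refl l₁) (crosses _ _ l₂) (stays refl l₀) = begin
        L s                  ≈⟨ l₀ ⟩
        0ℝ                   ≈⟨ ℛ.-‿inverseˡ (signedJump σ v u) ⟨
        - signedJump σ v u + signedJump σ v u
                             ≈⟨ ℛ.+-cong l l₂ ⟨
        t + L s₂             ≈⟨ ℛ.+-identityˡ (t + L s₂) ⟨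
        0ℝ + (t + L s₂)      ≈⟨ ℛ.+-congʳ l₁ ⟨
        L s₁ + (t + L s₂)    ∎
    detour-towards σ s s₁ s₂ e e₁ e₂ z≢z′ r l
      (stays refl _) (crosses z′≢y _ _) (crosses z≢y _ _) =
        ⊥-elim (z≢y (shared-edge (step-target-EdgeOf s₁ e₁) (step-source-EdgeOf s₂ e₂)
                                 (step-target-EdgeOf s e) z≢z′ z′≢y))

    -- Here `x` and `z` run the edge in opposite directions, so `s₁` must cross, and the face of `x`
    -- is that of `z′`. If `s₂` stays, the loop cancels `s₁`; if `s₂` crosses, the loop cancels `s₂`
    -- and `s₁` has the value of `s`.
    detour-away : ∀ σ {x y z z′} (s : Step S x y) (s₁ : Step S x z) (s₂ : Step S z′ y) {t} →
      edge S s ≃ (v , u) → edge S s₁ ≃ (v , u) → edge S s₂ ≃ (v , u) →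
      proj₁ z ≢ proj₁ z′ → Runs (opposite σ) z v u → t ≈ - signedJump σ v u → Runs σ x v u →
      Crossing σ v u s₁ → Crossing σ v u s₂ → Crossing σ v u s →
      L s ≈ L s₁ + (t + L s₂)
    detour-away σ s s₁ s₂ e e₁ e₂ z≢z′ r l r′ (stays refl _) _ _ =
      ⊥-elim (Runs-asymmetric σ _ r′ r)
    detour-away {v} {u} σ s s₁ s₂ {t} e e₁ e₂ z≢z′ r l r′
      (crosses _ _ l₁) (stays refl l₂) (stays refl l₀) = begin
        L s                  ≈⟨ l₀ ⟩
        0ℝ                   ≈⟨ ℛ.-‿inverseʳ (signedJump σ v u) ⟨
        signedJump σ v u - signedJump σ v u
                             ≈⟨ ℛ.+-cong l₁ l ⟨
        L s₁ + t             ≈⟨ ℛ.+-congˡ (ℛ.+-identityʳ t) ⟨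
        L s₁ + (t + 0ℝ)      ≈⟨ ℛ.+-congˡ (ℛ.+-congˡ l₂) ⟨
        L s₁ + (t + L s₂)    ∎
    detour-away σ s s₁ s₂ e e₁ e₂ z≢z′ r l r′
      (crosses x≢z _ _) (stays refl _) (crosses x≢y _ _) =
        ⊥-elim (x≢y (shared-edge (step-source-EdgeOf s e) (step-target-EdgeOf s₁ e₁)
                                 (step-target-EdgeOf s e) x≢z z≢z′))
    detour-away σ s s₁ s₂ e e₁ e₂ z≢z′ r l r′
      (crosses x≢z _ _) (crosses z′≢y _ _) (stays refl _) =
        ⊥-elim (z′≢y (≡.sym (shared-edge (step-source-EdgeOf s e) (step-target-EdgeOf s₁ e₁)
                                         (step-source-EdgeOf s₂ e₂) x≢z z≢z′)))
    detour-away {v} {u} σ s s₁ s₂ {t} e e₁ e₂ z≢z′ r l r′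
      (crosses _ _ l₁) (crosses _ _ l₂) (crosses _ _ l₀) = begin
        L s                  ≈⟨ l₀ ⟩
        signedJump σ v u     ≈⟨ l₁ ⟨
        L s₁                 ≈⟨ ℛ.+-identityʳ (L s₁) ⟨
        L s₁ + 0ℝ            ≈⟨ ℛ.+-congˡ (ℛ.-‿inverseˡ (signedJump σ v u)) ⟨
        L s₁ + (- signedJump σ v u + signedJump σ v u)
                             ≈⟨ ℛ.+-congˡ (ℛ.+-cong l l₂) ⟨
        L s₁ + (t + L s₂)    ∎

    -- Turning around a vertex.

    -- δ turns around v, its first face having been entered through the edge vu.
    -- The last face has one more edge at v; whether it closes up with vu is
    -- left open, hence the second alternative in `covers`.
    record Fan (σ : Sign) (v u : Vertex) {x y} (δ : OrientedFacePath S x y) : Set where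
      field
        rim       : List Vertex
        edges-rim : edges S δ ≡ map (dart σ v) rim
        lift-rim  : T δ ≈ ∑ (signedJump σ v) rim
        adjacent  : All (Adjacent v) rim
        tip       : Vertex
        tip∈rim   : tip ∈ rim
        enters    : Runs (opposite σ) y v tip
        covers    : ∀ {g t} → g ∈ faces S δ → EdgeOf g v t → t ∈ u ∷ rim ⊎ Runs σ y v t

    -- A face has just two edges at `v`, one run towards `v` and one away from it. The edge `vu`
    -- takes one direction, so the new edge takes the other, and the next face again runs it in the
    -- direction in which `x` ran `vu`: the sense of turning persists.
    turn : ∀ σ (s : Step S x y) → proj₁ x ≢ proj₁ y → Runs (opposite σ) x v u →
      _∈ₑ_ S v (edge S s) → ¬ (dart σ v u ≃ edge S s) →
      ∃[ t ] (edge S s ≡ dart σ v t × Adjacent v t × Runs σ x v t ×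
              Runs (opposite σ) y v t × L s ≈ signedJump σ v t)
    turn {x} {v = v} σ s x≢y r v∈s new with opposite-end v∈s
    ... | t , e with Runs-dichotomy σ x (step-source-EdgeOf s e)
    ...   | inj₁ r′ with refl ← Runs-unique (opposite σ) x r r′ =
      ⊥-elim (new (≃-trans (dart-≃ σ) (≃-sym e)))
    ...   | inj₂ r′ with crossing σ s r′ e
    ...     | stays refl _ = ⊥-elim (x≢y refl)
    ...     | crosses _ r″ l =
      t , edge≡dart σ s r′ e , (_ , step-source-EdgeOf s e) , r′ , r″ , l

    -- Induction along the loop: the edge through which a face is left is the entering edge of the
    -- next. Each face but the last has both of its edges at `v` accounted for.
    fan : ∀ σ (δ : OrientedFacePath S x y) → Runs (opposite σ) x v u →
      All (_∈ₑ_ S v) (edges S δ) → AllPairs (λ a b → ¬ (a ≃ b)) (dart σ v u ∷ edges S δ) →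
      Unique (faces S δ) → Fan σ v u δ
    fan {x} {y} σ [ s ] r (v∈s ∷ []) ((new ∷ []) ∷ _) ((x≢y ∷ []) ∷ _)
      with turn σ s x≢y r v∈s new
    ... | t , e , a , out , inn , l = record
      { rim = t ∷ [] ; edges-rim = cong (_∷ []) e
      ; lift-rim = ℛ.trans l (ℛ.sym (ℛ.+-identityʳ _))
      ; adjacent = a ∷ [] ; tip = t ; tip∈rim = here refl ; enters = inn ; covers = covers }
      where
      covers : ∀ {g t′} → g ∈ faces S [ s ] → EdgeOf g _ t′ → t′ ∈ _ ∷ t ∷ [] ⊎ Runs σ y _ t′
      covers (here refl) b with Runs-dichotomy σ x b
      ... | inj₁ c = inj₁ (here (Runs-unique (opposite σ) x c r))
      ... | inj₂ c = inj₁ (there (here (Runs-unique σ x c out)))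
      covers (there (here refl)) b with Runs-dichotomy σ y b
      ... | inj₁ c = inj₁ (there (here (Runs-unique (opposite σ) y c inn)))
      ... | inj₂ c = inj₂ c
    fan {x} {y} {v} {u} σ (s ∷ δ) r (v∈s ∷ v∈δ) ((new ∷ _) ∷ distinct) (x∉ ∷ unique)
      with turn σ s (All.lookup x∉ (first-face δ)) r v∈s new
    ... | t , e , a , out , inn , l = record
      { rim = t ∷ rim ; edges-rim = ≡.cong₂ _∷_ e edges-rim
      ; lift-rim = ℛ.+-cong l lift-rim
      ; adjacent = a ∷ adjacent ; tip = tip ; tip∈rim = there tip∈rim ; enters = enters
      ; covers = covers′ }
      where
      -- The edge just crossed, rewritten as a dart at `v`, becomes the entering edge of the
      -- remaining path.
      open Fan (fan σ δ inn v∈δ (subst (λ d → AllPairs _ (d ∷ edges S δ)) e distinct) unique)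
      covers′ : ∀ {g t′} → g ∈ faces S (s ∷ δ) → EdgeOf g v t′ → t′ ∈ u ∷ t ∷ rim ⊎ Runs σ y v t′
      covers′ (here refl) b with Runs-dichotomy σ x b
      ... | inj₁ c = inj₁ (here (Runs-unique (opposite σ) x c r))
      ... | inj₂ c = inj₁ (there (here (Runs-unique σ x c out)))
      covers′ (there g∈δ) b with covers g∈δ b
      ... | inj₁ t′∈ = inj₁ (there t′∈)
      ... | inj₂ c   = inj₂ c

    rim-unique : ∀ σ {as : List (Vertex × Vertex)} {us} → as ≡ map (dart σ v) us →
      AllPairs (λ a b → ¬ (a ≃ b)) (dart σ v u ∷ as) → Unique (u ∷ us)
    rim-unique {v} σ refl distinct =
      AllPairs.map (λ { a≄b refl → a≄b (inj₁ (refl , refl)) })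
                   (AllPairsP.map⁻ {f = dart σ v} distinct)

    module _ (self-stress : IsSelfStress S w) where

      -- The self-stress condition and invariance under moves.

      ∑-jump≈0 : ∀ v → ∑ (jump v) (neighbours v) ≈ 0ℝ
      ∑-jump≈0 v = begin
        ∑ (jump v) (neighbours v)
          ≈⟨ det-sum₂ (weight v) (λ u → position v -₂ position u) _ (neighbours v) ⟨
        det (sum₂ (map (λ u → weight v u · (position v -₂ position u)) (neighbours v)))
            (position v -₂ P)
          ≈⟨ det-cong (self-stress v) (ℛ.refl , ℛ.refl) ⟩
        det 0₂ (position v -₂ P)
          ≈⟨ det-0ˡ _ ⟩
        0ℝ
          ∎

      ∑-signedJump≈0 : ∀ σ v → ∑ (signedJump σ v) (neighbours v) ≈ 0ℝ
      ∑-signedJump≈0 pos v = ∑-jump≈0 v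
      ∑-signedJump≈0 neg v = begin
        ∑ (signedJump neg v) (neighbours v)  ≈⟨ ∑-neg (jump v) (neighbours v) ⟩
        - ∑ (jump v) (neighbours v)          ≈⟨ ℛ.-‿cong (∑-jump≈0 v) ⟩
        - 0ℝ                                 ≈⟨ ℛP.-0#≈0# ⟩
        0ℝ                                   ∎

      -- The vertex `u` and the rim together list every neighbour of `v` exactly once, so their
      -- signed jumps add up to 0.
      fan-lift : ∀ {σ} {δ : OrientedFacePath S x y} (F : Fan σ v u δ) →
        Unique (u ∷ Fan.rim F) → Adjacent v u → Runs σ y v u →
        (∀ g → CornerOf g v → g ∈ faces S δ) →
        T δ ≈ - signedJump σ v u
      fan-lift {y = y} {v} {u} {σ} {δ} F unique a r all = ℛP.+-inverseʳ-unique _ _ (begin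
        signedJump σ v u + T δ               ≈⟨ ℛ.+-congˡ lift-rim ⟩
        ∑ (signedJump σ v) (u ∷ rim)         ≈⟨ ∑-↭ (signedJump σ v) rim↭neighbours ⟩
        ∑ (signedJump σ v) (neighbours v)    ≈⟨ ∑-signedJump≈0 σ v ⟩
        0ℝ                                   ∎)
        where
        open Fan F
        to : ∀ {t} → t ∈ u ∷ rim → t ∈ neighbours v
        to t∈ = neighbour⁺ (All.lookup (a ∷ adjacent) t∈)
        from : ∀ {t} → t ∈ neighbours v → t ∈ u ∷ rim
        from t∈ with neighbour⁻ t∈
        ... | g , b with covers (all g (EdgeOf⇒CornerOf b)) b
        ...   | inj₁ t∈′ = t∈′
        -- The remaining edge of the last face is `vu` itself, by `r`: the fan closes up.
        ...   | inj₂ r′  = here (Runs-unique σ y r′ r)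
        rim↭neighbours : u ∷ rim ↭ neighbours v
        rim↭neighbours = ∼bag⇒↭ (unique∧set⇒bag unique (neighbours-unique v) (mk⇔ to from))

      -- The direction in which `z` runs the edge fixes the sense `σ` of turning; the direction in
      -- which `x` runs it tells whether `s₁` stays or crosses.
      around-invariant : ∀ {x y z z′ v} {s : Step S x y}
        (s₁ : Step S x z) (δ : OrientedFacePath S z z′) (s₂ : Step S z′ y) →
        edge S s₁ ≃ edge S s → edge S s₂ ≃ edge S s → Around S v (edge S s) δ →
        L s ≈ L s₁ + (T δ + L s₂)
      around-invariant {x} {y} {z} {z′} {v} {s} s₁ δ s₂ e₁ e₂ A =
        either-way (Runs-dichotomy pos z z∋)
        where
        open Around A
        far = proj₁ (opposite-end endpoint)
        e = proj₂ (opposite-end endpoint)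
        e₁′ = ≃-trans e₁ e
        e₂′ = ≃-trans e₂ e
        z∋ = step-target-EdgeOf s₁ e₁′

        z≢z′ : proj₁ z ≢ proj₁ z′
        z≢z′ = end-faces-distinct δ faces-distinct

        turn-back : ∀ σ → Runs (opposite σ) z v far → Runs σ z′ v far × T δ ≈ - signedJump σ v far
        turn-back σ r = exit , fan-lift F unique (_ , z∋) exit all-faces
          where
          new : All (λ a → ¬ (dart σ v far ≃ a)) (edges S δ)
          new = All.map (λ e≄a d≃a → e≄a (≃-trans e (≃-trans (≃-sym (dart-≃ σ)) d≃a)))
                        (AllPairs.head edges-distinct)
          distinct = new ∷ AllPairs.tail edges-distinct
          F = fan σ δ r edges-at-v distinct faces-distinct
          unique = rim-unique σ (Fan.edges-rim F) distinct
          -- Otherwise the edge to `far` would be the one through which the last face was entered,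
          -- and the loop would have crossed the edge at which it is inserted.
          exit : Runs σ z′ v far
          exit with Runs-dichotomy σ z′ (step-source-EdgeOf s₂ e₂′)
          ... | inj₂ r′ = r′
          ... | inj₁ r′ = ⊥-elim (All.lookup (AllPairs.head unique) (Fan.tip∈rim F)
                            (Runs-unique (opposite σ) z′ r′ (Fan.enters F)))

        detour : ∀ σ → Runs (opposite σ) z v far → Runs (opposite σ) x v far ⊎ Runs σ x v far →
          L s ≈ L s₁ + (T δ + L s₂)
        detour σ r (inj₁ rx) = let exit , l = turn-back σ r in
          detour-towards σ s s₁ s₂ e e₁′ e₂′ z≢z′ r l
            (crossing (opposite σ) s₁ rx e₁′) (crossing σ s₂ exit e₂′)
            (crossing (opposite σ) s rx e)
        detour σ r (inj₂ rx) = let exit , l = turn-back σ r in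
          detour-away σ s s₁ s₂ e e₁′ e₂′ z≢z′ r l rx
            (crossing σ s₁ rx e₁′) (crossing σ s₂ exit e₂′) (crossing σ s rx e)

        either-way : Runs neg z v far ⊎ Runs pos z v far → L s ≈ L s₁ + (T δ + L s₂)
        -- The sign passed on is opposite to the direction found at `z`, since the first face of a
        -- fan runs its entering edge in direction `opposite σ`.
        either-way (inj₁ r) = detour pos r (Runs-dichotomy pos x (step-source-EdgeOf s e))
        either-way (inj₂ r) = detour neg r (Runs-dichotomy neg x (step-source-EdgeOf s e))

      insertion-invariant : {s : Step S x y} {δ : OrientedFacePath S x y} →
        Insertion S s δ → L s ≈ T δ
      insertion-invariant {s = s} (double s₁ t s₂ e₁ e₂) =
        double-invariant {s = s} s₁ t s₂ e₁ e₂
      insertion-invariant {s = s} (around v s₁ δ s₂ e₁ e₂ A) = ℛ.trans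
        (around-invariant {s = s} s₁ δ s₂ e₁ e₂ A) (ℛ.+-congˡ (ℛ.sym (lift-∷ʳ δ s₂)))

      move-invariant : {γ γ′ : OrientedFacePath S x y} → Move S γ γ′ → T γ ≈ T γ′
      move-invariant (only i)              = insertion-invariant i
      move-invariant (here {δ = δ} {γ} i)  =
        ℛ.trans (ℛ.+-congʳ (insertion-invariant i)) (ℛ.sym (lift-++ δ γ))
      move-invariant (there m)             = ℛ.+-congˡ (move-invariant m)

theorem2p8 : (S : PolygonalSurface) (w : Stress S) → IsSelfStress S w →
    (f f′ : PolygonalSurface.Face S) (o o′ : Sign)
    (γ γ′ : OrientedFacePath S (f , o) (f′ , o′)) → Homotopic S γ γ′ →
    (p : ℝ²) → lift S γ w p ≈ lift S γ′ w p
theorem2p8 S w self-stress f f′ o o′ γ γ′ γ∼γ′ p =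
  gfold ℛ.isEquivalence (λ δ → lift S δ w p) (move-invariant S w p self-stress) γ∼γ′
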